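{- Let $\mathcal M$ be a map on a surface with set of edges $E$ and set of coedges $E^*$. The set of bases of $\mathcal M$ (equivalently, the set of bases of its Lagrangian matroid $\Delta(\mathcal M)$) is in one-to-one correspondence with the partial duals of $\mathcal M$ that have exactly one face, the correspondence being given by $B\mapsto\partial_{E\setminus B}\mathcal M$. Here partial duals are not considered up to isomorphism: for subsets $A_1\neq A_2$ of $E$, the partial duals $\partial_{A_1}\mathcal M$ and $\partial_{A_2}\mathcal M$ are regarded as distinct even if they are isomorphic as maps. (That is, $B\mapsto E\setminus B$ is a bijection from the set of bases of $\mathcal M$ onto the set of those $A\subseteq E$ for which $\partial_A\mathcal M$ has exactly one face.)
   Context: A map $\mathcal M$ on a surface $S$ is a cellular embedding of a connected graph (loops and multiple edges allowed) into a connected, closed, orientable surface $S$; the connected components of the complement of the graph are the faces, each homeomorphic to an open disc. Let $E=\{e_1,\dots,e_n\}$ be its edges. The dual map $\mathcal M^*$ on $S$ has one vertex (covertex) in each face of $\mathcal M$, and for each edge $e_j$ of $\mathcal M$ an edge (coedge) $e_j^*$ joining the face-centres of the face(s) on the two sides of $e_j$, crossing $e_j$ exactly once and meeting no other edge of $\mathcal M$. Let $E^*=\{e_1^*,\dots,e_n^*\}$. An $n$-subset $B\subset E\cup E^*$ is admissible if for each $j$ exactly one of $e_j,e_j^*$ lies in $B$. A base of $\mathcal M$ is an admissible $n$-subset $B$ such that $S\setminus B$ (the complement of the union of the edges and coedges in $B$) is connected. The bases of $\mathcal M$ are the bases of a Lagrangian matroid denoted $\Delta(\mathcal M)$. For a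 base $B$, $E\setminus B$ is the set of edges of $\mathcal M$ not in $B$. Cartographic description: divide each edge into two half-edges and label the $2n$ half-edges by $\{1,\dots,2n\}$. Then $\mathcal M$ is encoded by $\langle\sigma,\alpha,\varphi\rangle$ with $\sigma,\alpha,\varphi\in S_{2n}$: cycles of $\sigma$ are the counter-clockwise orderings of half-edges around vertices, cycles of $\alpha$ are the pairs of half-edges forming an edge, cycles of $\varphi$ are the counter-clockwise orderings of labels within faces; $\alpha$ is a fixed-point free involution, $\sigma\alpha\varphi=1$ (permutations act on the right), and the group generated is transitive. Conversely such a triple determines a map up to isomorphism, and vertices, edges, faces correspond to cycles of $\sigma,\alpha,\varphi$. Partial dual: write $\alpha=c_1\cdots c_n$ as a product of disjoint transpositions, $c_j$ corresponding to the edge $e_j$. For $A=\{e_{i_1},\dots,e_{i_k}\}\subseteq E$, the partial dual of $\mathcal M$ with respect to $A$ is the map $\partial_A\mathcal M=\langle\sigma c_{i_1}\cdots c_{i_k},\ \alpha,\ c_{i_1}\cdots c_{i_k}\varphi\rangle$. -}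

module Defs where

open import Data.Bool.Base using (Bool; true; false; not)
open import Data.Fin.Base using (Fin; _↑ˡ_; _↑ʳ_)
open import Data.Fin.Properties using (_≟_)
open import Data.Fin.Permutation
  using (Permutation′; _⟨$⟩ʳ_; _≈_; _∘ₚ_; id; transpose)
open import Data.Fin.Subset using (Subset; _∈_; _∉_; ∣_∣; ∁)
open import Data.Fin.Subset.Properties using (_∈?_)
open import Data.List.Base using (List; []; _∷_; allFin; filter; foldr; map)
open import Data.Nat.Base using (ℕ; _+_; _*_)
open import Data.Product.Base using (Σ; Σ-syntax; ∃-syntax; _×_; _,_; proj₁; proj₂)
open import Data.Sum.Base using (_⊎_; inj₁; inj₂)
open import Data.Vec.Base using (take)
open import Function.Bundles using (_↔_; Inverse)
open import Level using (0ℓ)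
open import Relation.Binary.Bundles using (Setoid)
open import Relation.Binary.Construct.Closure.Equivalence as Eq using (EqClosure)
import Relation.Binary.Construct.On as On
open import Relation.Binary.PropositionalEquality
  using (_≡_; _≢_; refl; sym; trans; cong; subst; setoid)
open import Relation.Nullary using (¬_; yes; no; contradiction)

private
  variable
    n : ℕ

-- One step of the action of ⟨σ , α , φ⟩ on the labels.
data Generated (σ α φ : Permutation′ n) : Fin n → Fin n → Set where
  by-σ : ∀ i → Generated σ α φ i (σ ⟨$⟩ʳ i)
  by-α : ∀ i → Generated σ α φ i (α ⟨$⟩ʳ i)
  by-φ : ∀ i → Generated σ α φ i (φ ⟨$⟩ʳ i)

-- The cartographic description ⟨σ , α , φ⟩ of a map with n edges.  `_∘ₚ_`
-- composes from left to right, i.e. permutations act on the right.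
-- `half-edges` numbers the edges: e_j consists of the half-edges labelled
-- half (j , false) and half (j , true), which form the transposition c_j of α.
-- For n = 0 there is exactly one such triple; it stands for the map with one
-- vertex and no edges on the sphere (see `Place`).
record Map (n : ℕ) : Set where
  field
    σ α φ            : Permutation′ (2 * n)
    α-involutive     : ∀ i → α ⟨$⟩ʳ (α ⟨$⟩ʳ i) ≡ i
    α-fixedPointFree : ∀ i → α ⟨$⟩ʳ i ≢ i
    σαφ≈id           : σ ∘ₚ α ∘ₚ φ ≈ id
    connected        : ∀ i j → EqClosure (Generated σ α φ) i j
    half-edges       : (Fin n × Bool) ↔ Fin (2 * n)

  half : Fin n × Bool → Fin (2 * n)
  half = Inverse.to half-edges

  edge : Fin (2 * n) → Fin n
  edge d = proj₁ (Inverse.from half-edges d)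

  field
    α-half : ∀ j s → α ⟨$⟩ʳ half (j , s) ≡ half (j , not s)

  c : Fin n → Permutation′ (2 * n)
  c j = transpose (half (j , false)) (half (j , true))

  ∏c : List (Fin n) → Permutation′ (2 * n)
  ∏c js = foldr _∘ₚ_ id (map c js)

  c[_] : Subset n → Permutation′ (2 * n)
  c[ A ] = ∏c (filter (_∈? A) (allFin n))

module _ (M : Map n) where
  open Map M

  private
    c-local : ∀ j d → c j ⟨$⟩ʳ d ≡ d ⊎ c j ⟨$⟩ʳ d ≡ α ⟨$⟩ʳ d
    c-local j d with d ≟ half (j , false)
    ... | yes refl = inj₂ (sym (α-half j false))
    ... | no _ with d ≟ half (j , true)
    ...   | yes refl = inj₂ (sym (α-half j true))
    ...   | no _     = inj₁ refl

    α-switch : ∀ {x y} → α ⟨$⟩ʳ x ≡ y → α ⟨$⟩ʳ y ≡ x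
    α-switch {x} refl = α-involutive x

    c-α : ∀ j d → c j ⟨$⟩ʳ (α ⟨$⟩ʳ d) ≡ α ⟨$⟩ʳ (c j ⟨$⟩ʳ d)
    c-α j d with d ≟ half (j , false)
    c-α j d | yes refl
      with α ⟨$⟩ʳ half (j , false) ≟ half (j , false)
    ... | yes eq = contradiction eq (α-fixedPointFree _)
    ... | no _ with α ⟨$⟩ʳ half (j , false) ≟ half (j , true)
    ...   | yes _  = sym (α-half j true)
    ...   | no neq = contradiction (α-half j false) neq
    c-α j d | no d≢f with d ≟ half (j , true)
    c-α j d | no d≢f | yes refl
      with α ⟨$⟩ʳ half (j , true) ≟ half (j , false)
    ... | yes _  = sym (α-half j false)
    ... | no neq = contradiction (α-half j true) neq
    c-α j d | no d≢f | no d≢t with α ⟨$⟩ʳ d ≟ half (j , false)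
    ... | yes eq =
      contradiction (trans (sym (α-switch eq)) (α-half j false)) d≢t
    ... | no _ with α ⟨$⟩ʳ d ≟ half (j , true)
    ...   | yes eq =
      contradiction (trans (sym (α-switch eq)) (α-half j true)) d≢f
    ...   | no _   = refl

    ∏c-local : ∀ js d → ∏c js ⟨$⟩ʳ d ≡ d ⊎ ∏c js ⟨$⟩ʳ d ≡ α ⟨$⟩ʳ d
    ∏c-local []       d = inj₁ refl
    ∏c-local (j ∷ js) d with c-local j d | ∏c-local js (c j ⟨$⟩ʳ d)
    ... | inj₁ p | inj₁ q = inj₁ (trans q p)
    ... | inj₁ p | inj₂ q = inj₂ (trans q (cong (α ⟨$⟩ʳ_) p))
    ... | inj₂ p | inj₁ q = inj₂ (trans q p)
    ... | inj₂ p | inj₂ q =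
      inj₁ (trans q (trans (cong (α ⟨$⟩ʳ_) p) (α-involutive d)))

    ∏c-α : ∀ js d → ∏c js ⟨$⟩ʳ (α ⟨$⟩ʳ d) ≡ α ⟨$⟩ʳ (∏c js ⟨$⟩ʳ d)
    ∏c-α []       d = refl
    ∏c-α (j ∷ js) d =
      trans (cong (∏c js ⟨$⟩ʳ_) (c-α j d)) (∏c-α js (c j ⟨$⟩ʳ d))

    ∏c-involutive : ∀ js d → ∏c js ⟨$⟩ʳ (∏c js ⟨$⟩ʳ d) ≡ d
    ∏c-involutive js d with ∏c-local js d
    ... | inj₁ p = trans (cong (∏c js ⟨$⟩ʳ_) p) p
    ... | inj₂ p = trans (cong (∏c js ⟨$⟩ʳ_) p)
                     (trans (∏c-α js d) (α-switch (sym p)))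

    module Dual (js : List (Fin n)) where
      σ′ φ′ : Permutation′ (2 * n)
      σ′ = σ ∘ₚ ∏c js
      φ′ = ∏c js ∘ₚ φ

      _~_ : Fin (2 * n) → Fin (2 * n) → Set
      _~_ = EqClosure (Generated σ′ α φ′)

      ~sym : ∀ {i j} → i ~ j → j ~ i
      ~sym = Eq.symmetric _

      ~trans : ∀ {i j k} → i ~ j → j ~ k → i ~ k
      ~trans = Eq.transitive _

      ~∏c : ∀ d → d ~ (∏c js ⟨$⟩ʳ d)
      ~∏c d with ∏c-local js d
      ... | inj₁ p = subst (d ~_) (sym p) (Eq.reflexive _)
      ... | inj₂ p = subst (d ~_) (sym p) (Eq.return (by-α d))

      step : ∀ {i j} → Generated σ α φ i j → i ~ j
      step (by-σ i) = ~trans (Eq.return (by-σ i)) (~sym (~∏c (σ ⟨$⟩ʳ i)))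
      step (by-α i) = Eq.return (by-α i)
      step (by-φ i) = ~trans (~∏c i)
        (subst (λ d → (∏c js ⟨$⟩ʳ i) ~ (φ ⟨$⟩ʳ d)) (∏c-involutive js i)
          (Eq.return (by-φ (∏c js ⟨$⟩ʳ i))))

      σ′αφ′≈id : σ′ ∘ₚ α ∘ₚ φ′ ≈ id
      σ′αφ′≈id i = trans
        (cong (φ ⟨$⟩ʳ_)
          (trans (∏c-α js (∏c js ⟨$⟩ʳ (σ ⟨$⟩ʳ i)))
                 (cong (α ⟨$⟩ʳ_) (∏c-involutive js (σ ⟨$⟩ʳ i)))))
        (σαφ≈id i)

  ∂ : Subset n → Map n
  ∂ A = record
    { σ                = σ ∘ₚ c[ A ]
    ; α                = α
    ; φ                = c[ A ] ∘ₚ φ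
    ; α-involutive     = α-involutive
    ; α-fixedPointFree = α-fixedPointFree
    ; σαφ≈id           = Dual.σ′αφ′≈id js
    ; connected        = λ i j → Eq._⋆ (Dual.step js) (connected i j)
    ; half-edges       = half-edges
    ; α-half           = α-half
    }
    where js = filter (_∈? A) (allFin n)

-- Vertices, faces and corners are named by the labels lying on them.  The
-- edgeless map has no labels, yet it has one vertex, one face and one corner:
-- these are named `bare`.
data Place : ℕ → Set where
  ⟨_⟩  : Fin (2 * n) → Place n
  bare : Place 0

data Step (π : Permutation′ (2 * n)) : Place n → Place n → Set where
  step : ∀ d → Step π ⟨ d ⟩ ⟨ π ⟨$⟩ʳ d ⟩

SameCycle : Permutation′ (2 * n) → Place n → Place n → Set
SameCycle π = EqClosure (Step π)

HasExactlyOneFace : Map n → Set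
HasExactlyOneFace {n} M =
  Σ[ f ∈ Place n ] (∀ g → SameCycle (Map.φ M) f g)

-- The face-centre `covertex ⟨ d ⟩` lies in the face whose φ-cycle contains d.
-- `crossing j` is the point where e_j meets e_j*.  `half-edge d` is the open
-- arc from the vertex of d to the crossing on the edge of d, and
-- `half-coedge d` the open arc from that crossing to the centre of the face of
-- d.  `corner ⟨ d ⟩` is the open region at the vertex of d between d and its
-- counter-clockwise successor σ d.  Since α σ d = φ⁻¹ d, the face containing
-- that region is the face of d, and its boundary consists of the half-edges
-- d, σ d and the half-coedges d, φ⁻¹ d.  In the edgeless map the only region
-- is the sphere minus its vertex and its covertex (an open annulus).
data Cell (n : ℕ) : Set where
  vertex covertex corner : Place n → Cell n
  crossing               : Fin n → Cell n
  half-edge half-coedge  : Fin (2 * n) → Cell n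

module _ (M : Map n) where
  open Map M

  -- x ≺ y : x is contained in the closure of y, or x and y are two names
  -- of the same point.
  data _≺_ : Cell n → Cell n → Set where
    vertex-name          : ∀ {x y} → Step σ x y → vertex x ≺ vertex y
    covertex-name        : ∀ {x y} → Step φ x y → covertex x ≺ covertex y
    vertex-half-edge     : ∀ d → vertex ⟨ d ⟩ ≺ half-edge d
    crossing-half-edge   : ∀ d → crossing (edge d) ≺ half-edge d
    covertex-half-coedge : ∀ d → covertex ⟨ d ⟩ ≺ half-coedge d
    crossing-half-coedge : ∀ d → crossing (edge d) ≺ half-coedge d
    half-edge-corner     : ∀ d → half-edge d ≺ corner ⟨ d ⟩
    half-edge-corner′    : ∀ d → half-edge (σ ⟨$⟩ʳ d) ≺ corner ⟨ d ⟩
    half-coedge-corner   : ∀ d → half-coedge d ≺ corner ⟨ d ⟩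
    half-coedge-corner′  : ∀ d → half-coedge d ≺ corner ⟨ φ ⟨$⟩ʳ d ⟩
    vertex-corner        : ∀ x → vertex x ≺ corner x
    covertex-corner      : ∀ x → covertex x ≺ corner x
    crossing-corner      : ∀ d → crossing (edge d) ≺ corner ⟨ d ⟩
    crossing-corner′     : ∀ d → crossing (edge (σ ⟨$⟩ʳ d)) ≺ corner ⟨ d ⟩

  -- The cells making up e_j and e_j*, end points included.
  data OnEdge : Fin n → Cell n → Set where
    interior : ∀ d → OnEdge (edge d) (half-edge d)
    middle   : ∀ j → OnEdge j (crossing j)
    end      : ∀ d {x} → SameCycle σ ⟨ d ⟩ x → OnEdge (edge d) (vertex x)

  data OnCoedge : Fin n → Cell n → Set where
    interior : ∀ d → OnCoedge (edge d) (half-coedge d)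
    middle   : ∀ j → OnCoedge j (crossing j)
    end      : ∀ d {x} → SameCycle φ ⟨ d ⟩ x → OnCoedge (edge d) (covertex x)

-- E ∪ E* is Fin (n + n): the edges come first, followed by the coedges.
e e* : Fin n → Fin (n + n)
e  {n} j = j ↑ˡ n
e* {n} j = n ↑ʳ j

E∖_ : Subset (n + n) → Subset n
E∖_ {n} B = ∁ (take n B)

module _ (M : Map n) (B : Subset (n + n)) where

  InUnion : Cell n → Set
  InUnion x = ∃[ j ] ((e j ∈ B × OnEdge M j x) ⊎ (e* j ∈ B × OnCoedge M j x))

  data Adjacent : Cell n → Cell n → Set where
    adjacent : ∀ {x y} → ¬ InUnion x → ¬ InUnion y → _≺_ M x y → Adjacent x y

  -- S ∖ B is a union of cells; it is connected when any two of its cells are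
  -- joined by a chain of cells of S ∖ B, each incident with the next.  It is
  -- never empty, as it contains all the corners.
  ComplementConnected : Set
  ComplementConnected =
    ∀ x y → ¬ InUnion x → ¬ InUnion y → EqClosure Adjacent x y

  Admissible : Set
  Admissible = ∀ (j : Fin n) → (e j ∈ B × e* j ∉ B) ⊎ (e j ∉ B × e* j ∈ B)

  record IsBase : Set where
    field
      size       : ∣ B ∣ ≡ n
      admissible : Admissible
      connected  : ComplementConnected

-- Bases are equal when they are equal as sets.
Bases : Map n → Setoid 0ℓ 0ℓ
Bases {n} M = On.setoid {B = Σ[ B ∈ Subset (n + n) ] IsBase M B}
  (setoid (Subset (n + n))) proj₁

-- ∂ M A₁ and ∂ M A₂ are equal only when A₁ and A₂ are.
OneFacePartialDuals : Map n → Setoid 0ℓ 0ℓ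
OneFacePartialDuals {n} M =
  On.setoid {B = Σ[ A ∈ Subset n ] HasExactlyOneFace (∂ M A)}
    (setoid (Subset n)) proj₁

{-# OPTIONS --safe #-}
-- For A ⊆ E put B = (E ∖ A) ∪ A*, so that E ∖ B = A, and let φ′ = c_A φ be the
-- face permutation of ∂_A M.  The corners of M at d and φ′ d are neighbours
-- across an arc that B leaves open: if the edge of d is in A, then
-- φ′ d = φ (α d) = σ⁻¹ d and the two corners share the half-edge d; otherwise
-- φ′ d = φ d and they share the half-coedge d.  There are no other crossings
-- between corners off B, so the components of S ∖ B are the faces of ∂_A M.
module Submission where

open import Data.Bool.Base using (true; false)
open import Data.Bool.Properties using (not-involutive)
open import Data.Fin.Base using (Fin; zero)
open import Data.Fin.Permutation using (_⟨$⟩ʳ_; _⟨$⟩ˡ_; inverseʳ)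
open import Data.Fin.Properties using (_≟_)
open import Data.Fin.Subset using (Subset; inside; outside; _∈_; _∉_; ∣_∣; ∁)
open import Data.Fin.Subset.Properties using (_∈?_; ⊆-antisym; x∈∁p⇒x∉p; x∉p⇒x∈∁p)
open import Data.List.Base using ([]; _∷_; allFin)
import Data.List.Membership.Propositional as List
open import Data.List.Membership.Propositional.Properties using (∈-filter⁺; ∈-filter⁻; ∈-allFin)
open import Data.List.Relation.Unary.Any using (here; there)
open import Data.List.Relation.Unary.AllPairs using (_∷_)
open import Data.List.Relation.Unary.Unique.Propositional using (Unique)
open import Data.List.Relation.Unary.Unique.Propositional.Properties using (allFin⁺; filter⁺; Unique[x∷xs]⇒x∉xs)
open import Data.Nat.Base using (ℕ; zero; suc; _+_)
open import Data.Nat.Properties using (+-suc)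
open import Data.Product.Base using (Σ-syntax; _,_; proj₁; proj₂)
open import Data.Sum.Base using (inj₁; inj₂)
open import Data.Vec.Base using ([]; _∷_; _++_; take; drop)
open import Data.Vec.Properties using ([]=⇒lookup; lookup⇒[]=; lookup-++ˡ; lookup-++ʳ; take++drop≡id)
open import Function.Base using (_∘_)
open import Function.Bundles using (Bijection; Inverse)
open import Relation.Binary.Construct.Closure.Equivalence as Eq using (EqClosure)
open import Relation.Binary.PropositionalEquality
open import Relation.Nullary using (¬_; yes; no; contradiction)
open import Defs

private
  variable
    m n : ℕ

-- Complements and concatenations of subsets.

∁-involutive : (p : Subset n) → ∁ (∁ p) ≡ p
∁-involutive []      = refl
∁-involutive (s ∷ p) = cong₂ _∷_ (not-involutive s) (∁-involutive p)

∣p++q∣ : (p : Subset m) (q : Subset n) → ∣ p ++ q ∣ ≡ ∣ p ∣ + ∣ q ∣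
∣p++q∣ []            q = refl
∣p++q∣ (inside ∷ p)  q = cong suc (∣p++q∣ p q)
∣p++q∣ (outside ∷ p) q = ∣p++q∣ p q

∣∁p∣+∣p∣≡n : (p : Subset n) → ∣ ∁ p ∣ + ∣ p ∣ ≡ n
∣∁p∣+∣p∣≡n []            = refl
∣∁p∣+∣p∣≡n (inside ∷ p)  = trans (+-suc ∣ ∁ p ∣ ∣ p ∣) (cong suc (∣∁p∣+∣p∣≡n p))
∣∁p∣+∣p∣≡n (outside ∷ p) = cong suc (∣∁p∣+∣p∣≡n p)

take-++ : (p : Subset m) (q : Subset n) → take m (p ++ q) ≡ p
take-++ []      q = refl
take-++ (s ∷ p) q = cong (s ∷_) (take-++ p q)

module _ (p q : Subset n) {j : Fin n} where

  e∈++⁻ : e j ∈ p ++ q → j ∈ p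
  e∈++⁻ j∈ = lookup⇒[]= j p (trans (sym (lookup-++ˡ p q j)) ([]=⇒lookup j∈))

  e∈++⁺ : j ∈ p → e j ∈ p ++ q
  e∈++⁺ j∈ = lookup⇒[]= (e j) (p ++ q) (trans (lookup-++ˡ p q j) ([]=⇒lookup j∈))

  e*∈++⁻ : e* j ∈ p ++ q → j ∈ q
  e*∈++⁻ j∈ = lookup⇒[]= j q (trans (sym (lookup-++ʳ p q j)) ([]=⇒lookup j∈))

  e*∈++⁺ : j ∈ q → e* j ∈ p ++ q
  e*∈++⁺ j∈ = lookup⇒[]= (e* j) (p ++ q) (trans (lookup-++ʳ p q j) ([]=⇒lookup j∈))

-- The inverse of the correspondence: the one admissible set whose edges are those outside `A`.
fromComplement : Subset n → Subset (n + n)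
fromComplement A = ∁ A ++ A

E∖-fromComplement : (A : Subset n) → E∖ (fromComplement A) ≡ A
E∖-fromComplement A = trans (cong ∁ (take-++ (∁ A) A)) (∁-involutive A)

∣fromComplement∣ : (A : Subset n) → ∣ fromComplement A ∣ ≡ n
∣fromComplement∣ A = trans (∣p++q∣ (∁ A) A) (∣∁p∣+∣p∣≡n A)

module _ (M : Map n) where
  open Map M

  -- The action of `c[ A ]` on half-edges.

  half∘from : ∀ d → half (edge d , proj₂ (Inverse.from half-edges d)) ≡ d
  half∘from d = Inverse.inverseˡ half-edges refl

  edge-half : ∀ j s → edge (half (j , s)) ≡ j
  edge-half j s = cong proj₁ (Inverse.inverseʳ half-edges refl)

  edge-α : ∀ d → edge (α ⟨$⟩ʳ d) ≡ edge d
  edge-α d = trans (cong (λ x → edge (α ⟨$⟩ʳ x)) (sym (half∘from d)))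
    (trans (cong edge (α-half (edge d) _)) (edge-half (edge d) _))

  c-fixes : ∀ j d → j ≢ edge d → c j ⟨$⟩ʳ d ≡ d
  c-fixes j d j≢ with d ≟ half (j , false)
  ... | yes refl = contradiction (sym (edge-half j false)) j≢
  ... | no _ with d ≟ half (j , true)
  ...   | yes refl = contradiction (sym (edge-half j true)) j≢
  ...   | no _     = refl

  c-edge : ∀ d → c (edge d) ⟨$⟩ʳ d ≡ α ⟨$⟩ʳ d
  c-edge d = trans (cong (c (edge d) ⟨$⟩ʳ_) (sym (half∘from d)))
    (trans (c-half (edge d) _) (cong (α ⟨$⟩ʳ_) (half∘from d)))
    where
    c-half : ∀ j s → c j ⟨$⟩ʳ half (j , s) ≡ α ⟨$⟩ʳ half (j , s)
    c-half j s with half (j , s) ≟ half (j , false)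
    ... | yes eq = trans (sym (α-half j false)) (cong (α ⟨$⟩ʳ_) (sym eq))
    c-half j false | no neq = contradiction refl neq
    c-half j true  | no _ with half (j , true) ≟ half (j , true)
    ... | yes _  = sym (α-half j true)
    ... | no neq = contradiction refl neq

  ∏c-fixes : ∀ js d → edge d List.∉ js → ∏c js ⟨$⟩ʳ d ≡ d
  ∏c-fixes []       d d∉ = refl
  ∏c-fixes (j ∷ js) d d∉ =
    trans (cong (∏c js ⟨$⟩ʳ_) (c-fixes j d (d∉ ∘ here ∘ sym))) (∏c-fixes js d (d∉ ∘ there))

  -- The transpositions are disjoint, so only the factor of the edge of `d` moves `d`, and the later
  -- factors fix `α d`, which lies on the same edge. A repeated factor would undo the move, hence
  -- `Unique`.
  ∏c-edge : ∀ {js} → Unique js → ∀ d → edge d List.∈ js → ∏c js ⟨$⟩ʳ d ≡ α ⟨$⟩ʳ d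
  ∏c-edge {_ ∷ js} uniq d (here refl) = trans (cong (∏c js ⟨$⟩ʳ_) (c-edge d))
    (∏c-fixes js (α ⟨$⟩ʳ d) (Unique[x∷xs]⇒x∉xs uniq ∘ subst (List._∈ js) (edge-α d)))
  ∏c-edge {j ∷ js} uniq@(_ ∷ uniq′) d (there d∈) = trans (cong (∏c js ⟨$⟩ʳ_) (c-fixes j d j≢))
    (∏c-edge uniq′ d d∈)
    where
    j≢ : j ≢ edge d
    j≢ refl = Unique[x∷xs]⇒x∉xs uniq d∈

  c[]-fixes : ∀ A d → edge d ∉ A → c[ A ] ⟨$⟩ʳ d ≡ d
  c[]-fixes A d d∉ = ∏c-fixes _ d (d∉ ∘ proj₂ ∘ ∈-filter⁻ (_∈? A) {xs = allFin n})

  c[]-edge : ∀ A d → edge d ∈ A → c[ A ] ⟨$⟩ʳ d ≡ α ⟨$⟩ʳ d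
  c[]-edge A d d∈ = ∏c-edge (filter⁺ (_∈? A) (allFin⁺ n)) d
    (∈-filter⁺ (_∈? A) (∈-allFin (edge d)) d∈)

  -- Components of the complement and faces of the partial dual.

  module _ (A : Subset n) where

    private
      B : Subset (n + n)
      B = fromComplement A

      φ′ = Map.φ (∂ M A)

      Off : Cell n → Set
      Off x = ¬ InUnion M B x

      _≈_ : Place n → Place n → Set
      _≈_ = SameCycle φ′

      _~_ : Cell n → Cell n → Set
      _~_ = EqClosure (Adjacent M B)

    φ′-∉ : ∀ d → edge d ∉ A → φ′ ⟨$⟩ʳ d ≡ φ ⟨$⟩ʳ d
    φ′-∉ d d∉ = cong (φ ⟨$⟩ʳ_) (c[]-fixes A d d∉)

    -- Here `c[ A ]` acts as `α`, and `σαφ≈id` at `d` finishes. Taking `σ d` as the argument avoids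
    -- the inverse of `σ`.
    φ′-∈ : ∀ d → edge (σ ⟨$⟩ʳ d) ∈ A → φ′ ⟨$⟩ʳ (σ ⟨$⟩ʳ d) ≡ d
    φ′-∈ d d∈ = trans (cong (φ ⟨$⟩ʳ_) (c[]-edge A _ d∈)) (σαφ≈id d)

    off-half-edge : ∀ {d} → edge d ∈ A → Off (half-edge d)
    off-half-edge d∈ (_ , inj₁ (j∈ , interior _)) = x∈∁p⇒x∉p (e∈++⁻ (∁ A) A j∈) d∈
    off-half-edge d∈ (_ , inj₂ (_ , ()))

    off-half-coedge : ∀ {d} → edge d ∉ A → Off (half-coedge d)
    off-half-coedge d∉ (_ , inj₁ (_ , ()))
    off-half-coedge d∉ (_ , inj₂ (j∈ , interior _)) = d∉ (e*∈++⁻ (∁ A) A j∈)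

    off-corner : ∀ {x} → Off (corner x)
    off-corner (_ , inj₁ (_ , ()))
    off-corner (_ , inj₂ (_ , ()))

    -- For `j` outside `A` the edge would belong to `B` and contain `x`. Since membership in `A` is
    -- decidable, refuting that case is enough.
    avoids-edge : ∀ {j x} → OnEdge M j x → Off x → j ∈ A
    avoids-edge {j} on off with j ∈? A
    ... | yes j∈ = j∈
    ... | no  j∉ = contradiction (j , inj₁ (e∈++⁺ (∁ A) A (x∉p⇒x∈∁p j∉) , on)) off

    avoids-coedge : ∀ {j x} → OnCoedge M j x → Off x → j ∉ A
    avoids-coedge {j} on off j∈ = off (j , inj₂ (e*∈++⁺ (∁ A) A j∈ , on))

    -- The crossing lies on both the edge and the coedge, so avoiding `B` would put `j` in `A` and
    -- outside `A` at once.
    ¬off-crossing : ∀ {j} → ¬ Off (crossing j)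
    ¬off-crossing off = avoids-coedge (middle _) off (avoids-edge (middle _) off)

    link-∈ : ∀ d → edge (σ ⟨$⟩ʳ d) ∈ A → ⟨ σ ⟨$⟩ʳ d ⟩ ≈ ⟨ d ⟩
    link-∈ d d∈ = subst (λ x → ⟨ σ ⟨$⟩ʳ d ⟩ ≈ ⟨ x ⟩) (φ′-∈ d d∈) (Eq.return (step (σ ⟨$⟩ʳ d)))

    link-∉ : ∀ d → edge d ∉ A → ⟨ d ⟩ ≈ ⟨ φ ⟨$⟩ʳ d ⟩
    link-∉ d d∉ = subst (λ x → ⟨ d ⟩ ≈ ⟨ x ⟩) (φ′-∉ d d∉) (Eq.return (step d))

    -- The value at a crossing is arbitrary: crossings lie on B.
    face : Cell n → Place n
    face (vertex x)      = x
    face (covertex x)    = x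
    face (corner x)      = x
    face (crossing j)    = ⟨ half (j , false) ⟩
    face (half-edge d)   = ⟨ d ⟩
    face (half-coedge d) = ⟨ d ⟩

    -- Each incidence either keeps the place or moves it by a single step of `φ′`, forwards or
    -- backwards: the arc or point used is off `B`, which decides whether the edge concerned is in
    -- `A`. Incidences with crossings cannot occur off `B`.
    face-adjacent : ∀ {x y} → Adjacent M B x y → face x ≈ face y
    -- The edge of `σ d` ends at this vertex; as the vertex is off `B`, that edge is in `A`, and
    -- passing from `d` to `σ d` reverses a step of `φ′`.
    face-adjacent (adjacent _ oy (vertex-name (step d))) =
      Eq.symmetric _ (link-∈ d (avoids-edge (end (σ ⟨$⟩ʳ d) (Eq.reflexive _)) oy))
    face-adjacent (adjacent ox _ (covertex-name (step d))) =
      link-∉ d (avoids-coedge (end d (Eq.reflexive _)) ox)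
    face-adjacent (adjacent _ _ (vertex-half-edge d)) = Eq.reflexive _
    face-adjacent (adjacent ox _ (crossing-half-edge d)) = contradiction ox ¬off-crossing
    face-adjacent (adjacent _ _ (covertex-half-coedge d)) = Eq.reflexive _
    face-adjacent (adjacent ox _ (crossing-half-coedge d)) = contradiction ox ¬off-crossing
    face-adjacent (adjacent _ _ (half-edge-corner d)) = Eq.reflexive _
    face-adjacent (adjacent ox _ (half-edge-corner′ d)) =
      link-∈ d (avoids-edge (interior (σ ⟨$⟩ʳ d)) ox)
    face-adjacent (adjacent _ _ (half-coedge-corner d)) = Eq.reflexive _
    face-adjacent (adjacent ox _ (half-coedge-corner′ d)) =
      link-∉ d (avoids-coedge (interior d) ox)
    face-adjacent (adjacent _ _ (vertex-corner x)) = Eq.reflexive _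
    face-adjacent (adjacent _ _ (covertex-corner x)) = Eq.reflexive _
    face-adjacent (adjacent ox _ (crossing-corner d)) = contradiction ox ¬off-crossing
    face-adjacent (adjacent ox _ (crossing-corner′ d)) = contradiction ox ¬off-crossing

    -- Corners are never in `B` and `face (corner f)` is `f`, so a chain of cells between two
    -- corners maps to a chain of steps of `φ′`.
    connected⇒sameFace : ComplementConnected M B → ∀ f g → f ≈ g
    connected⇒sameFace conn f g =
      Eq.gfold (Eq.isEquivalence _) face face-adjacent
        (conn (corner f) (corner g) off-corner off-corner)

    -- For a cell off `B` other than a corner, `face x` names a corner with `x` in its closure, so
    -- one incidence suffices. Connectedness then only has to be checked between corners.
    corner-face : ∀ x → Off x → x ~ corner (face x)
    corner-face (vertex x)      o = Eq.return (adjacent o off-corner (vertex-corner x))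
    corner-face (covertex x)    o = Eq.return (adjacent o off-corner (covertex-corner x))
    corner-face (corner x)      o = Eq.reflexive _
    corner-face (crossing j)    o = contradiction o ¬off-crossing
    corner-face (half-edge d)   o = Eq.return (adjacent o off-corner (half-edge-corner d))
    corner-face (half-coedge d) o = Eq.return (adjacent o off-corner (half-coedge-corner d))

    corner-across-half-edge : ∀ d → edge (σ ⟨$⟩ʳ d) ∈ A → corner ⟨ σ ⟨$⟩ʳ d ⟩ ~ corner ⟨ d ⟩
    corner-across-half-edge d d∈ = Eq.transitive _
      (Eq.symmetric _ (corner-face (half-edge _) o))
      (Eq.return (adjacent o off-corner (half-edge-corner′ d)))
      where o = off-half-edge d∈

    corner-across-half-coedge : ∀ d → edge d ∉ A → corner ⟨ d ⟩ ~ corner ⟨ φ ⟨$⟩ʳ d ⟩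
    corner-across-half-coedge d d∉ = Eq.transitive _
      (Eq.symmetric _ (corner-face (half-coedge _) o))
      (Eq.return (adjacent o off-corner (half-coedge-corner′ d)))
      where o = off-half-coedge d∉

    corner-step : ∀ {x y} → Step φ′ x y → corner x ~ corner y
    corner-step (step d) with edge d ∈? A
    ... | no d∉ = subst (λ x → corner ⟨ d ⟩ ~ corner ⟨ x ⟩) (sym (φ′-∉ d d∉))
                    (corner-across-half-coedge d d∉)
    -- `corner-across-half-edge` starts from a label of the form `σ d₀`, so `d` is written as `σ` of
    -- its `σ`-predecessor. The inner `subst` turns `d₀` into `φ′ (σ d₀)`, the outer one `σ d₀` back
    -- into `d`.
    ... | yes d∈ = subst (λ x → corner ⟨ x ⟩ ~ corner ⟨ φ′ ⟨$⟩ʳ x ⟩) (inverseʳ σ)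
                     (subst (λ x → corner ⟨ σd₀ ⟩ ~ corner ⟨ x ⟩) (sym (φ′-∈ d₀ d₀∈))
                       (corner-across-half-edge d₀ d₀∈))
      where
      d₀ = σ ⟨$⟩ˡ d
      σd₀ = σ ⟨$⟩ʳ d₀
      d₀∈ : edge σd₀ ∈ A
      d₀∈ = subst (λ x → edge x ∈ A) (sym (inverseʳ σ)) d∈

    sameFace⇒corner~ : ∀ {f g} → f ≈ g → corner f ~ corner g
    sameFace⇒corner~ = Eq.gfold (Eq.isEquivalence _) corner corner-step

    oneFace⇒connected : HasExactlyOneFace (∂ M A) → ComplementConnected M B
    oneFace⇒connected (f , f≈) x y ox oy =
      Eq.transitive _ (corner-face x ox) (Eq.transitive _
        (sameFace⇒corner~ (Eq.transitive _ (Eq.symmetric _ (f≈ (face x))) (f≈ (face y))))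
        (Eq.symmetric _ (corner-face y oy)))

    -- Admissible sets, bases and the bijection.

    fromComplement-admissible : Admissible M B
    fromComplement-admissible j with j ∈? A
    ... | yes j∈ = inj₂ ((λ ej∈ → x∈∁p⇒x∉p (e∈++⁻ (∁ A) A ej∈) j∈) , e*∈++⁺ (∁ A) A j∈)
    ... | no  j∉ = inj₁ (e∈++⁺ (∁ A) A (x∉p⇒x∈∁p j∉) , j∉ ∘ e*∈++⁻ (∁ A) A)

    oneFace⇒isBase : HasExactlyOneFace (∂ M A) → IsBase M B
    oneFace⇒isBase one = record
      { size       = ∣fromComplement∣ A
      ; admissible = fromComplement-admissible
      ; connected  = oneFace⇒connected one
      }

  -- Admissibility makes the coedge half of `B` the complement of its edge half, so `B` is
  -- determined by its edges. Injectivity rests on this.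
  admissible⇒fromComplement : ∀ B → Admissible M B → fromComplement (E∖_ {n} B) ≡ B
  admissible⇒fromComplement B adm = begin
    ∁ (∁ p) ++ ∁ p  ≡⟨ cong₂ _++_ (∁-involutive p) ∁p≡q ⟩
    p ++ q          ≡⟨ take++drop≡id n B ⟩
    B               ∎
    where
    open ≡-Reasoning
    p q : Subset n
    p = take n B
    q = drop n B

    -- Written as a concatenation, the set lets membership be read off in each half.
    adm′ : Admissible M (p ++ q)
    adm′ = subst (Admissible M) (sym (take++drop≡id n B)) adm

    ∁p⊆q : ∀ {j} → j ∈ ∁ p → j ∈ q
    ∁p⊆q {j} j∈ with adm′ j
    ... | inj₁ (ej∈ , _)  = contradiction (e∈++⁻ p q ej∈) (x∈∁p⇒x∉p j∈)
    ... | inj₂ (_ , e*j∈) = e*∈++⁻ p q e*j∈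

    q⊆∁p : ∀ {j} → j ∈ q → j ∈ ∁ p
    q⊆∁p {j} j∈ with adm′ j
    ... | inj₁ (_ , e*j∉) = contradiction (e*∈++⁺ p q j∈) e*j∉
    ... | inj₂ (ej∉ , _)  = x∉p⇒x∈∁p (ej∉ ∘ e∈++⁺ p q)

    ∁p≡q : ∁ p ≡ q
    ∁p≡q = ⊆-antisym ∁p⊆q q⊆∁p

-- `HasExactlyOneFace` asks for a face to be exhibited; without edges there is no label, and `bare`
-- names the only face.
somePlace : (M : Map n) → Place n
somePlace {zero}  M = bare
somePlace {suc n} M = ⟨ Map.half M (zero , false) ⟩

isBase⇒oneFace : (M : Map n) (B : Subset (n + n)) → IsBase M B → HasExactlyOneFace (∂ M (E∖ B))
isBase⇒oneFace {n} M B base = somePlace M , connected⇒sameFace M (E∖_ {n} B)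
  -- The hypothesis concerns `B`, the lemma `fromComplement (E∖ B)`; admissibility identifies them.
  (subst (ComplementConnected M) (sym (admissible⇒fromComplement M B admissible)) connected)
  (somePlace M)
  where open IsBase base

theorem3p2 : ∀ {n : ℕ} (M : Map n) →
    Σ[ β ∈ Bijection (Bases M) (OneFacePartialDuals M) ]
    (∀ B → proj₁ (Bijection.to β B) ≡ E∖ (proj₁ B))
theorem3p2 {n} M = record
  { to        = λ (B , base) → E∖ B , isBase⇒oneFace M B base
  ; cong      = cong (E∖_ {n})
  ; bijective = (λ {x} {y} → injective x y) , surjective
  } , λ _ → refl
  where
  injective : ∀ x y → E∖_ {n} (proj₁ x) ≡ E∖_ {n} (proj₁ y) → proj₁ x ≡ proj₁ y
  injective (B , base) (B′ , base′) eq = begin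
    B                           ≡⟨ admissible⇒fromComplement M B (IsBase.admissible base) ⟨
    fromComplement (E∖_ {n} B)   ≡⟨ cong fromComplement eq ⟩
    fromComplement (E∖_ {n} B′)  ≡⟨ admissible⇒fromComplement M B′ (IsBase.admissible base′) ⟩
    B′                          ∎
    where open ≡-Reasoning

  surjective = λ (A , one) → (fromComplement A , oneFace⇒isBase M A one) ,
    -- Surjectivity is demanded for every base with the same underlying set as the witness, hence
    -- `eq`.
    λ eq → trans (cong (E∖_ {n}) eq) (E∖-fromComplement A)
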